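{- Let $b$ be a nonzero integer and let $k\geq 1$ be an integer with $k\in\chi(0,b)$. Let $p$ be an odd prime that is a $k$-PL prime relative to $(0,b)$, and suppose that $(F_1/p)=(F_2/p)=1$, where $F_i$ is the $i$th term of the $(0,b)$-Fibonacci sequence. Let $G$ be a connected graph of order $n$ and size $n(2k-1)+\varepsilon$, where $\varepsilon\in\{ -1,0,1\}$. Then the corona graph $G\circ P_{\pi_p(0,b)-1}$ is a $(0,b)$-FLC graph modulo $p$.
   Context: All graphs are finite and simple with nonempty vertex set; order means number of vertices and size means number of edges. For integers $a,b$, the $(a,b)$-Fibonacci sequence is $F_0=a$, $F_1=b$, $F_n=F_{n-1}+F_{n-2}$ for $n\ge 2$. $(x/p)$ denotes the Legendre symbol for an odd prime $p$ (equal to $0$ when $p\mid x$). The $(a,b)$-Pisano period $\pi_p(a,b)$ is the smallest positive integer $t$ such that $F_{n+t}\equiv F_n \pmod p$ for all $n\ge 0$. For an odd prime $p$ and $j\in\{ -1,0,1\}$, let $\Lambda_j^p(a,b)=\{\xi\in\{0,1,\ldots,\pi_p(a,b)-1\} : (F_\xi/p)=j\}$. The prime $p$ is a $k$-PL prime ($k$-Pisano-Legendre prime) relative to $(a,b)$ if $k=|\Lambda_1^p(a,b)|-|\Lambda_{ -1}^p(a,b)|-|\Lambda_0^p(a,b)|$. The Pisano set $\chi(a,b)$ is the set of all integers $k$ for which there exists an odd prime $p$ that is a $k$-PL prime relative to $(a,b)$. Let $\Gamma$ be a simple connected graph of order $N$. A bijection $f:V(\Gamma)\to\{0,1,\ldots,N-1\}$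 is an $(a,b)$-FLC labeling (Fibonacci-Legendre cordial labeling) modulo $p$ if the induced edge labeling $f_p^*:E(\Gamma)\to\{0,1\}$, given by $f_p^*(uv)=\frac{1+([F_{f(u)}+F_{f(v)}]/p)}{2}$ if $F_{f(u)}+F_{f(v)}\not\equiv 0\pmod p$ and $f_p^*(uv)=0$ otherwise, satisfies $|e_{f_p^*}(0)-e_{f_p^*}(1)|\le 1$, where $e_{f_p^*}(i)$ is the number of edges labeled $i$. A graph admitting such a labeling is an $(a,b)$-FLC graph modulo $p$. $P_n$ is the path graph on $n$ vertices. If $G_1$ has order $n$, the corona graph $G_1\circ G_2$ is obtained by taking one copy of $G_1$ and $n$ disjoint copies of $G_2$, and joining the $i$th vertex of $G_1$ to every vertex of the $i$th copy of $G_2$. -}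

module Defs where

open import Data.Fin using (Fin; toℕ; fromℕ<; combine)
import Data.Fin as Fin
open import Data.Fin.Properties using (any?; pigeonhole; combine-injective; fromℕ<-injective; +↔⊎; *↔×)
import Data.Fin.Properties as Fin
open import Data.Integer using (ℤ; +_; _+_; _*_; _-_; -_; 0ℤ; 1ℤ; -1ℤ; ∣_∣)
import Data.Integer.Properties as ℤ
open import Data.Integer.DivMod using (_/_; _%ℕ_; _/ℕ_; n%ℕd<d; a≡a%ℕn+[a/ℕn]*n)
open import Data.Integer.Divisibility.Signed using (_∣_; divides; _∣?_; ∣m∣n⇒∣m+n; ∣m∣n⇒∣m-n; ∣n⇒∣m*n; ∣m⇒∣-m)
open import Data.Integer.Tactic.RingSolver using (solve-∀)
open import Data.List using (List; filter; length; upTo; map; allFin; cartesianProduct)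
open import Data.Nat as ℕ using (ℕ; zero; suc; NonZero; _≤_; _<_)
import Data.Nat.Divisibility as ℕ
open import Data.Nat.Induction using (<-rec)
open import Data.Nat.Primality using (Prime; prime⇒nonZero)
import Data.Nat.Properties as ℕ
open import Data.Product using (∃; ∃-syntax; _×_; _,_; proj₁; proj₂)
open import Data.Product.Function.NonDependent.Propositional using (_×-↔_)
open import Data.Sum using (_⊎_; inj₁; inj₂)
open import Data.Sum.Function.Propositional using (_⊎-↔_)
open import Function using (_↔_; _⤖_; Inverse; Bijection)
open import Function.Construct.Composition using (_↔-∘_)
open import Function.Construct.Identity using (↔-id)
open import Function.Construct.Symmetry using (↔-sym)
open import Function.Properties.Inverse using (↔⇒↣)
open import Level using (0ℓ)
open import Relation.Binary using (Decidable; Symmetric; DecidableEquality)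
open import Relation.Binary.Construct.Closure.ReflexiveTransitive using (Star)
open import Relation.Binary.PropositionalEquality using (_≡_; _≢_; refl; sym; trans; cong; subst)
open import Relation.Nullary using (¬_; Dec; yes; no)
open import Relation.Nullary.Decidable using (map′; _×-dec_; _⊎-dec_; via-injection)
open import Relation.Unary using (Pred)

record OddPrime : Set where
  field
    val   : ℕ
    prime : Prime val
    odd   : ¬ (2 ℕ.∣ val)

  instance
    val≢0 : NonZero val
    val≢0 = prime⇒nonZero prime

open OddPrime using (val)

infix 4 _≡_[mod_] _≡?_[mod_]

_≡_[mod_] : ℤ → ℤ → ℕ → Set
x ≡ y [mod m ] = + m ∣ x - y

_≡?_[mod_] : ∀ x y m → Dec (x ≡ y [mod m ])
x ≡? y [mod m ] = + m ∣? x - y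

≡mod-reflexive : ∀ {m x y} → x ≡ y → x ≡ y [mod m ]
≡mod-reflexive {m} {x} refl = divides 0ℤ (ℤ.+-inverseʳ x)

≡mod-trans : ∀ {m x y z} → x ≡ y [mod m ] → y ≡ z [mod m ] → x ≡ z [mod m ]
≡mod-trans {m} {x} {y} {z} d e = subst (+ m ∣_) (lemma x y z) (∣m∣n⇒∣m+n d e)
  where
  lemma : ∀ x y z → (x - y) + (y - z) ≡ x - z
  lemma = solve-∀

≡mod-sym : ∀ {m x y} → x ≡ y [mod m ] → y ≡ x [mod m ]
≡mod-sym {m} {x} {y} d = subst (+ m ∣_) (lemma x y) (∣m⇒∣-m d)
  where
  lemma : ∀ x y → - (x - y) ≡ y - x
  lemma = solve-∀

≡mod-+ : ∀ {m x x′ y y′} → x ≡ x′ [mod m ] → y ≡ y′ [mod m ] → x + y ≡ x′ + y′ [mod m ]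
≡mod-+ {m} {x} {x′} {y} {y′} d e = subst (+ m ∣_) (lemma x x′ y y′) (∣m∣n⇒∣m+n d e)
  where
  lemma : ∀ x x′ y y′ → (x - x′) + (y - y′) ≡ (x + y) - (x′ + y′)
  lemma = solve-∀

≡mod-+-cancelˡ : ∀ {m x x′ y y′} → x ≡ x′ [mod m ] → x + y ≡ x′ + y′ [mod m ] → y ≡ y′ [mod m ]
≡mod-+-cancelˡ {m} {x} {x′} {y} {y′} d e = subst (+ m ∣_) (lemma x x′ y y′) (∣m∣n⇒∣m-n e d)
  where
  lemma : ∀ x x′ y y′ → ((x + y) - (x′ + y′)) - (x - x′) ≡ y - y′
  lemma = solve-∀

≡mod-% : ∀ x m .{{_ : NonZero m}} → x ≡ + (x %ℕ m) [mod m ]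
≡mod-% x m = divides (x /ℕ m)
  (trans (cong (_- + (x %ℕ m)) (a≡a%ℕn+[a/ℕn]*n x m)) (lemma (+ (x %ℕ m)) _))
  where
  lemma : ∀ r s → (r + s) - r ≡ s
  lemma = solve-∀

residue : (P : OddPrime) → ℤ → Fin (val P)
residue P x = fromℕ< (n%ℕd<d x (val P))
  where open OddPrime P using (val≢0)

IsSquareMod : ℕ → ℤ → Set
IsSquareMod m x = ∃[ y ] (y * y ≡ x [mod m ])

isSquareMod? : ∀ (P : OddPrime) x → Dec (IsSquareMod (val P) x)
isSquareMod? P x = map′ to from (any? λ r → + toℕ r * + toℕ r ≡? x [mod val P ])
  where
  open OddPrime P using (val≢0)

  to : (∃ λ (r : Fin (val P)) → + toℕ r * + toℕ r ≡ x [mod val P ]) → IsSquareMod (val P) x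
  to (r , d) = + toℕ r , d

  lemma : ∀ r y → (r + y) * (y - r) ≡ y * y - r * r
  lemma = solve-∀

  from : IsSquareMod (val P) x → ∃ λ (r : Fin (val P)) → + toℕ r * + toℕ r ≡ x [mod val P ]
  from (y , d) = residue P y , ≡mod-trans {x = + toℕ (residue P y) * + toℕ (residue P y)} {y = y * y} square d
    where
    square : + toℕ (residue P y) * + toℕ (residue P y) ≡ y * y [mod val P ]
    square rewrite Fin.toℕ-fromℕ< (n%ℕd<d y (val P)) =
      ≡mod-sym {x = y * y} (subst (+ val P ∣_) (lemma (+ (y %ℕ val P)) y)
        (∣n⇒∣m*n (+ (y %ℕ val P) + y) (≡mod-% y (val P))))

legendre : OddPrime → ℤ → ℤ
legendre P x with + val P ∣? x | isSquareMod? P x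
... | yes _ | _     = 0ℤ
... | no  _ | yes _ = 1ℤ
... | no  _ | no  _ = -1ℤ

F : ℤ → ℤ → ℕ → ℤ
F a b 0             = a
F a b 1             = b
F a b (suc (suc n)) = F a b (suc n) + F a b n

IsPeriod : ℤ → ℤ → OddPrime → ℕ → Set
IsPeriod a b P t = 0 < t × (∀ n → F a b (n ℕ.+ t) ≡ F a b n [mod val P ])

IsPisanoPeriod : ℤ → ℤ → OddPrime → ℕ → Set
IsPisanoPeriod a b P t = IsPeriod a b P t × (∀ s → IsPeriod a b P s → t ≤ s)

-- A period exists because two of the first p² + 1 pairs (Fᵢ , Fᵢ₊₁) agree
-- modulo p and the recurrence can be run backwards.  Whether t is a period
-- is decidable because it only depends on the pair (Fₜ , Fₜ₊₁).
module _ (a b : ℤ) (P : OddPrime) where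
  open OddPrime P using (val≢0)

  private
    p : ℕ
    p = val P

    f : ℕ → ℤ
    f = F a b

    _~_ : ℕ → ℕ → Set
    i ~ j = (f i ≡ f j [mod p ]) × (f (suc i) ≡ f (suc j) [mod p ])

    ~-suc : ∀ {i j} → i ~ j → suc i ~ suc j
    ~-suc {i} {j} (d , e) = e , ≡mod-+ {p} {f (suc i)} {f (suc j)} {f i} {f j} e d

    ~-pred : ∀ {i j} → suc i ~ suc j → i ~ j
    ~-pred {i} {j} (d , e) =
      ≡mod-+-cancelˡ {p} {f (suc i)} {f (suc j)} {f i} {f j} d e , d

    back : ∀ i d → (i ℕ.+ d) ~ i → d ~ 0
    back zero    d h = h
    back (suc i) d h = back i d (~-pred {i ℕ.+ d} {i} h)

    forth : ∀ {d} → d ~ 0 → ∀ n → (n ℕ.+ d) ~ n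
    forth h zero    = h
    forth {d} h (suc n) = ~-suc {n ℕ.+ d} {n} (forth h n)

    period? : ∀ t → Dec (IsPeriod a b P t)
    period? t = (0 ℕ.<? t) ×-dec map′ (λ h n → proj₁ (forth h n)) (λ h → h 0 , h 1)
      ((f t ≡? f 0 [mod p ]) ×-dec (f (suc t) ≡? f 1 [mod p ]))

    pair : Fin (suc (p ℕ.* p)) → Fin (p ℕ.* p)
    pair i = combine (residue P (f (toℕ i))) (residue P (f (suc (toℕ i))))

    residue-≡ : ∀ x y → residue P x ≡ residue P y → x ≡ y [mod p ]
    residue-≡ x y h = ≡mod-trans {p} {x} {+ (x %ℕ p)} {y} (≡mod-% x p)
      (subst (λ r → + r ≡ y [mod p ]) (sym (fromℕ<-injective _ _ (n%ℕd<d x p) (n%ℕd<d y p) h))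
        (≡mod-sym {p} {y} (≡mod-% y p)))

    somePeriod : ∃ (IsPeriod a b P)
    somePeriod with pigeonhole (ℕ.n<1+n (p ℕ.* p)) pair
    ... | i , j , i<j , eq with combine-injective _ _ _ _ eq
    ... | eq₀ , eq₁ = d , ℕ.m<n⇒0<n∸m i<j , λ n → proj₁ (forth (back (toℕ i) d i+d~i) n)
      where
      d : ℕ
      d = toℕ j ℕ.∸ toℕ i

      j~i : toℕ j ~ toℕ i
      j~i = residue-≡ (f (toℕ j)) (f (toℕ i)) (sym eq₀)
          , residue-≡ (f (suc (toℕ j))) (f (suc (toℕ i))) (sym eq₁)

      i+d~i : (toℕ i ℕ.+ d) ~ toℕ i
      i+d~i = subst (_~ toℕ i) (sym (ℕ.m+[n∸m]≡n (ℕ.<⇒≤ i<j))) j~i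

    least : ∀ t → IsPeriod a b P t → ∃ (IsPisanoPeriod a b P)
    least = <-rec _ λ t rec h → step t rec h (ℕ.anyUpTo? period? t)
      where
      step : ∀ t → (∀ {s} → s < t → IsPeriod a b P s → ∃ (IsPisanoPeriod a b P)) →
             IsPeriod a b P t → Dec (∃ λ s → s < t × IsPeriod a b P s) →
             ∃ (IsPisanoPeriod a b P)
      step t rec h (yes (s , s<t , k)) = rec s<t k
      step t rec h (no none)           = t , h , λ s k → ℕ.≮⇒≥ λ s<t → none (s , s<t , k)

  pisano-exists : ∃ (IsPisanoPeriod a b P)
  pisano-exists = least (proj₁ somePeriod) (proj₂ somePeriod)

  π : ℕ
  π = proj₁ pisano-exists

  π-isPisanoPeriod : IsPisanoPeriod a b P π
  π-isPisanoPeriod = proj₂ pisano-exists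

Λ : ℤ → OddPrime → ℤ → ℤ → List ℕ
Λ j P a b = filter (λ ξ → legendre P (F a b ξ) ℤ.≟ j) (upTo (π a b P))

IsPLPrime : ℤ → ℤ → ℤ → OddPrime → Set
IsPLPrime k a b P =
  k ≡ + length (Λ 1ℤ P a b) - + length (Λ -1ℤ P a b) - + length (Λ 0ℤ P a b)

χ : ℤ → ℤ → Pred ℤ 0ℓ
χ a b k = ∃[ P ] IsPLPrime k a b P

-- The vertex set may be empty here; nonemptiness is part of Connected.
record Graph : Set₁ where
  field
    V      : Set
    order  : ℕ
    enum   : V ↔ Fin order
    Adj    : V → V → Set
    adj?   : Decidable Adj
    symm   : Symmetric Adj
    irrefl : ∀ {v} → ¬ Adj v v

  index : V → Fin order
  index = Inverse.to enum

  _≟ⱽ_ : DecidableEquality V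
  _≟ⱽ_ = via-injection (↔⇒↣ enum) Fin._≟_

  vertices : List V
  vertices = map (Inverse.from enum) (allFin order)

  -- Each edge {u , v} is listed once, as the ordered pair in which u precedes
  -- v in the enumeration.
  edges : List (V × V)
  edges = filter (λ (u , v) → (index u Fin.<? index v) ×-dec adj? u v)
                 (cartesianProduct vertices vertices)

  size : ℕ
  size = length edges

  Connected : Set
  Connected = V × (∀ u v → Star Adj u v)

open Graph

path : ℕ → Graph
path n = record
  { V      = Fin n
  ; order  = n
  ; enum   = ↔-id _
  ; Adj    = λ i j → toℕ j ≡ suc (toℕ i) ⊎ toℕ i ≡ suc (toℕ j)
  ; adj?   = λ i j → (toℕ j ℕ.≟ suc (toℕ i)) ⊎-dec (toℕ i ℕ.≟ suc (toℕ j))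
  ; symm   = λ { (inj₁ e) → inj₂ e ; (inj₂ e) → inj₁ e }
  ; irrefl = λ { (inj₁ e) → ℕ.1+n≢n (sym e) ; (inj₂ e) → ℕ.1+n≢n (sym e) }
  }

-- inj₁ u is the vertex u of G; inj₂ (u , x) is the vertex x of the copy of H
-- attached to u.
module _ (G H : Graph) where

  CoronaV : Set
  CoronaV = V G ⊎ (V G × V H)

  CoronaAdj : CoronaV → CoronaV → Set
  CoronaAdj (inj₁ u)       (inj₁ v)       = Adj G u v
  CoronaAdj (inj₁ u)       (inj₂ (v , _)) = u ≡ v
  CoronaAdj (inj₂ (u , _)) (inj₁ v)       = u ≡ v
  CoronaAdj (inj₂ (u , x)) (inj₂ (v , y)) = u ≡ v × Adj H x y

  corona : Graph
  corona = record
    { V      = CoronaV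
    ; order  = order G ℕ.+ order G ℕ.* order H
    ; enum   = ↔-sym +↔⊎ ↔-∘ (enum G ⊎-↔ (↔-sym *↔× ↔-∘ (enum G ×-↔ enum H)))
    ; Adj    = CoronaAdj
    ; adj?   = dec
    ; symm   = λ {x} {y} → sy x y
    ; irrefl = λ {x} → irr x
    }
    where
    dec : Decidable CoronaAdj
    dec (inj₁ u)       (inj₁ v)       = adj? G u v
    dec (inj₁ u)       (inj₂ (v , _)) = _≟ⱽ_ G u v
    dec (inj₂ (u , _)) (inj₁ v)       = _≟ⱽ_ G u v
    dec (inj₂ (u , x)) (inj₂ (v , y)) = _≟ⱽ_ G u v ×-dec adj? H x y

    sy : ∀ x y → CoronaAdj x y → CoronaAdj y x
    sy (inj₁ _) (inj₁ _) e       = symm G e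
    sy (inj₁ _) (inj₂ _) e       = sym e
    sy (inj₂ _) (inj₁ _) e       = sym e
    sy (inj₂ _) (inj₂ _) (e , h) = sym e , symm H h

    irr : ∀ x → ¬ CoronaAdj x x
    irr (inj₁ _) e       = irrefl G e
    irr (inj₂ _) (_ , h) = irrefl H h

module _ (a b : ℤ) (P : OddPrime) (Γ : Graph) where

  endpointSum : V Γ ⤖ Fin (order Γ) → V Γ → V Γ → ℤ
  endpointSum f u v = F a b (toℕ (Bijection.to f u)) + F a b (toℕ (Bijection.to f v))

  inducedLabel : V Γ ⤖ Fin (order Γ) → V Γ → V Γ → ℤ
  inducedLabel f u v with endpointSum f u v ≡? 0ℤ [mod val P ]
  ... | yes _ = 0ℤ
  ... | no  _ = (1ℤ + legendre P (endpointSum f u v)) / + 2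

  e : V Γ ⤖ Fin (order Γ) → ℤ → ℕ
  e f i = length (filter (λ (u , v) → inducedLabel f u v ℤ.≟ i) (edges Γ))

  IsFLCLabeling : V Γ ⤖ Fin (order Γ) → Set
  IsFLCLabeling f = ∣ + e f 0ℤ - + e f 1ℤ ∣ ≤ 1

  IsFLCGraph : Set
  IsFLCGraph = Connected Γ × ∃[ f ] IsFLCLabeling f

-- Give the i-th vertex of G the label πi and its path the labels πi + 1 , … ,
-- πi + π − 1.  Modulo p an edge of G then has endpoint sum 0, the edges joining
-- a vertex to its path have the sums F₁ , … , F_{π−1}, and the path edges, by
-- the recurrence, the sums F₃ , … , F_π.  With R = e(0) − e(1) for the values
-- F₀ , … , F_{π−1}, so that R = −k, each copy contributes
-- (R − 1) + (R + 2) = 1 − 2k to e(0) − e(1), while G contributes its size.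
module Submission where

open import Defs
open import Data.Integer using (ℤ; +_; _+_; _*_; _-_; _≤_; 0ℤ; 1ℤ; -1ℤ)
open import Data.Nat using (_∸_)
open import Data.Sum using (_⊎_)
open import Relation.Binary.PropositionalEquality using (_≡_; _≢_)
open Graph

import Algebra.Properties.Semiring.Sum
open import Data.Bool using (if_then_else_)
open import Data.Fin using (Fin; zero; suc; toℕ; inject₁; _↑ˡ_; _↑ʳ_; combine; cast)
import Data.Fin as Fin
import Data.Fin.Properties as Fin
open import Data.Integer using (∣_∣)
open import Data.Integer.Divisibility.Signed using (_∣_; _∣?_; ∣m∣n⇒∣m-n)
import Data.Integer.Properties as ℤ
open import Data.Integer.Tactic.RingSolver using (solve-∀)
open import Data.List using (List; []; _∷_; _++_; map; filter; length; foldr; tabulate; allFin; applyUpTo; upTo; cartesianProduct)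
open import Data.Nat as ℕ using (ℕ; zero; suc; z≤n; s≤s)
import Data.Nat.Properties as ℕ
open import Data.Product using (_×_; _,_; proj₁; proj₂; uncurry)
open import Data.Product.Function.NonDependent.Propositional using (_×-↔_)
open import Data.Sum using (inj₁; inj₂)
open import Function using (_∘_; _↔_; _⤖_; Inverse; Bijection; mk↔ₛ′)
open import Function.Construct.Composition using (_↔-∘_)
open import Function.Construct.Identity using (↔-id)
open import Function.Construct.Symmetry using (↔-sym)
open import Function.Properties.Inverse using (↔⇒⤖)
open import Relation.Binary.Construct.Closure.ReflexiveTransitive as Star using (Star; _◅_; _◅◅_)
open import Relation.Binary.PropositionalEquality using (refl; sym; trans; cong; cong₂; subst; module ≡-Reasoning)
open import Relation.Nullary using (¬_; Dec; yes; no; does; contradiction)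
open import Relation.Nullary.Decidable using (_×-dec_)
open import Relation.Unary using (Pred; Decidable)

open Algebra.Properties.Semiring.Sum ℤ.+-*-semiring
  using (sum-syntax; sum-cong-≗; sum-init-last; ∑-distrib-+; *-distribˡ-sum)
open OddPrime using (val)

-- Indicators of decisions and finite sums over lists and over `Fin n`.

private
  variable
    A B : Set

-- Only `does d` is inspected, so the indicator of a decision on constructor-headed indices
-- computes; `∑-δ` and `edgeSum-path` write such values directly as 0 and 1.
ι : Dec A → ℤ
ι d = if does d then 1ℤ else 0ℤ

ι-yes : (d : Dec A) → A → ι d ≡ 1ℤ
ι-yes (yes _) _ = refl
ι-yes (no ¬a) a = contradiction a ¬a

ι-no : (d : Dec A) → ¬ A → ι d ≡ 0ℤ
ι-no (yes a) ¬a = contradiction a ¬a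
ι-no (no _)  _  = refl

-- Adjacency in a path or corona is decided by a different procedure from the one for its parts.
-- Logical equivalence of the two propositions is enough to identify the indicators.
ι-cong : (d : Dec A) (e : Dec B) → (A → B) → (B → A) → ι d ≡ ι e
ι-cong (yes a) e to from = sym (ι-yes e (to a))
ι-cong (no ¬a) e to from = sym (ι-no e (¬a ∘ from))

ι-× : (d : Dec A) (e : Dec B) → ι (d ×-dec e) ≡ ι d * ι e
ι-× (yes _) e = sym (ℤ.*-identityˡ (ι e))
ι-× (no _)  e = sym (ℤ.*-zeroˡ (ι e))

sumOver : List A → (A → ℤ) → ℤ
sumOver xs g = foldr (λ x s → g x + s) 0ℤ xs

sumOver-cong : ∀ (xs : List A) {g h : A → ℤ} → (∀ x → g x ≡ h x) → sumOver xs g ≡ sumOver xs h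
sumOver-cong []       eq = refl
sumOver-cong (x ∷ xs) eq = cong₂ _+_ (eq x) (sumOver-cong xs eq)

sumOver-- : ∀ (xs : List A) (g h : A → ℤ) →
            sumOver xs g - sumOver xs h ≡ sumOver xs (λ x → g x - h x)
sumOver-- []       g h = refl
sumOver-- (x ∷ xs) g h = trans (interchange (g x) _ (h x) _) (cong (_+_ (g x - h x)) (sumOver-- xs g h))
  where
  interchange : ∀ a b c d → (a + b) - (c + d) ≡ (a - c) + (b - d)
  interchange = solve-∀

sumOver-++ : ∀ (xs ys : List A) g → sumOver (xs ++ ys) g ≡ sumOver xs g + sumOver ys g
sumOver-++ []       ys g = sym (ℤ.+-identityˡ _)
sumOver-++ (x ∷ xs) ys g =
  trans (cong (_+_ (g x)) (sumOver-++ xs ys g)) (sym (ℤ.+-assoc (g x) _ _))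

sumOver-map : ∀ (f : A → B) xs g → sumOver (map f xs) g ≡ sumOver xs (g ∘ f)
sumOver-map f []       g = refl
sumOver-map f (x ∷ xs) g = cong (_+_ (g (f x))) (sumOver-map f xs g)

sumOver-cartesianProduct : ∀ (xs : List A) (ys : List B) g →
  sumOver (cartesianProduct xs ys) g ≡ sumOver xs (λ x → sumOver ys (λ y → g (x , y)))
sumOver-cartesianProduct []       ys g = refl
sumOver-cartesianProduct (x ∷ xs) ys g = trans
  (sumOver-++ (map (x ,_) ys) _ g)
  (cong₂ _+_ (sumOver-map (x ,_) ys g) (sumOver-cartesianProduct xs ys g))

sumOver-filter : ∀ {P : Pred A _} (P? : Decidable P) xs g →
  sumOver (filter P? xs) g ≡ sumOver xs (λ x → ι (P? x) * g x)
sumOver-filter P? []       g = refl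
sumOver-filter P? (x ∷ xs) g with P? x
... | yes _ = cong₂ _+_ (sym (ℤ.*-identityˡ (g x))) (sumOver-filter P? xs g)
... | no  _ = trans (sumOver-filter P? xs g)
  (sym (trans (cong (_+ sumOver xs (λ y → ι (P? y) * g y)) (ℤ.*-zeroˡ (g x))) (ℤ.+-identityˡ _)))

length-filter : ∀ {P : Pred A _} (P? : Decidable P) xs →
  + length (filter P? xs) ≡ sumOver xs (ι ∘ P?)
length-filter P? []       = refl
length-filter P? (x ∷ xs) with P? x
... | yes _ = cong (_+_ 1ℤ) (length-filter P? xs)
... | no  _ = trans (length-filter P? xs) (sym (ℤ.+-identityˡ _))

length-sumOver : ∀ (xs : List A) → + length xs ≡ sumOver xs (λ _ → 1ℤ)
length-sumOver []       = refl
length-sumOver (x ∷ xs) = cong (_+_ 1ℤ) (length-sumOver xs)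

sumOver-tabulate : ∀ n (f : Fin n → A) g → sumOver (tabulate f) g ≡ ∑[ i < n ] g (f i)
sumOver-tabulate zero    f g = refl
sumOver-tabulate (suc n) f g = cong (_+_ (g (f zero))) (sumOver-tabulate n (f ∘ suc) g)

sumOver-applyUpTo : ∀ n (f : ℕ → A) g → sumOver (applyUpTo f n) g ≡ ∑[ i < n ] g (f (toℕ i))
sumOver-applyUpTo zero    f g = refl
sumOver-applyUpTo (suc n) f g = cong (_+_ (g (f 0))) (sumOver-applyUpTo n (f ∘ suc) g)

∑-const : ∀ n x → ∑[ i < n ] x ≡ + n * x
∑-const zero    x = sym (ℤ.*-zeroˡ x)
∑-const (suc n) x = trans (cong (_+_ x) (∑-const n x)) (sym (ℤ.suc-* (+ n) x))

∑-zero : ∀ n → ∑[ i < n ] 0ℤ ≡ 0ℤ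
∑-zero n = trans (∑-const n 0ℤ) (ℤ.*-zeroʳ (+ n))

∑-↑ : ∀ m {n} (g : Fin (m ℕ.+ n) → ℤ) →
      ∑[ i < m ℕ.+ n ] g i ≡ ∑[ i < m ] g (i ↑ˡ n) + ∑[ j < n ] g (m ↑ʳ j)
∑-↑ zero    g = sym (ℤ.+-identityˡ _)
∑-↑ (suc m) g = trans (cong (_+_ (g zero)) (∑-↑ m (g ∘ suc))) (sym (ℤ.+-assoc (g zero) _ _))

∑-combine : ∀ m {n} (g : Fin (m ℕ.* n) → ℤ) →
            ∑[ i < m ℕ.* n ] g i ≡ ∑[ i < m ] ∑[ j < n ] g (combine i j)
∑-combine zero        g = refl
∑-combine (suc m) {n} g = trans (∑-↑ n g)
  (cong (_+_ (∑[ j < n ] g (combine {suc m} zero j))) (∑-combine m (g ∘ (n ↑ʳ_))))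

∑-δ : ∀ {n} (j : Fin n) (g : Fin n → ℤ) → ∑[ i < n ] (ι (j Fin.≟ i) * g i) ≡ g j
∑-δ {suc n} zero    g = begin
  1ℤ * g zero + ∑[ i < n ] (0ℤ * g (suc i))  ≡⟨ cong₂ _+_ (ℤ.*-identityˡ (g zero))
                                                  (sum-cong-≗ (λ i → ℤ.*-zeroˡ (g (suc i)))) ⟩
  g zero + ∑[ i < n ] 0ℤ                     ≡⟨ cong (_+_ (g zero)) (∑-zero n) ⟩
  g zero + 0ℤ                                ≡⟨ ℤ.+-identityʳ _ ⟩
  g zero                                     ∎
  where open ≡-Reasoning
∑-δ {suc n} (suc j) g = begin
  0ℤ * g zero + ∑[ i < n ] (ι (suc j Fin.≟ suc i) * g (suc i))
    ≡⟨ cong₂ _+_ (ℤ.*-zeroˡ (g zero)) (sum-cong-≗ λ i →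
         cong (_* g (suc i)) (ι-cong (suc j Fin.≟ suc i) (j Fin.≟ i) Fin.suc-injective (cong suc))) ⟩
  0ℤ + ∑[ i < n ] (ι (j Fin.≟ i) * g (suc i))
    ≡⟨ ℤ.+-identityˡ _ ⟩
  ∑[ i < n ] (ι (j Fin.≟ i) * g (suc i))
    ≡⟨ ∑-δ j (g ∘ suc) ⟩
  g (suc j) ∎
  where open ≡-Reasoning

-- Vertex sums and edge sums of a graph, and the edge sum of a path.

module _ (Γ : Graph) where

  vertexAt : Fin (order Γ) → V Γ
  vertexAt = Inverse.from (enum Γ)

  vertexSum : (V Γ → ℤ) → ℤ
  vertexSum g = ∑[ i < order Γ ] g (vertexAt i)

  edge? : ∀ u v → Dec (index Γ u Fin.< index Γ v × Adj Γ u v)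
  edge? u v = (index Γ u Fin.<? index Γ v) ×-dec adj? Γ u v

  edgeIndicator : V Γ → V Γ → ℤ
  edgeIndicator u v = ι (edge? u v)

  -- A double sum over all ordered pairs with an indicator, rather than a sum over the filtered list
  -- `edges`: in this form it can be split along the two kinds of corona vertices, or row by row for
  -- a path.
  edgeSum : (V Γ → V Γ → ℤ) → ℤ
  edgeSum w = vertexSum λ u → vertexSum λ v → edgeIndicator u v * w u v

  vertexSum-cong : ∀ {g h} → (∀ v → g v ≡ h v) → vertexSum g ≡ vertexSum h
  vertexSum-cong eq = sum-cong-≗ λ i → eq (vertexAt i)

  edgeSum-cong : ∀ {w w′} → (∀ u v → w u v ≡ w′ u v) → edgeSum w ≡ edgeSum w′
  edgeSum-cong eq = vertexSum-cong λ u → vertexSum-cong λ v → cong (edgeIndicator u v *_) (eq u v)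

  vertexSum-+ : ∀ g h → vertexSum (λ v → g v + h v) ≡ vertexSum g + vertexSum h
  vertexSum-+ g h = ∑-distrib-+ (g ∘ vertexAt) (h ∘ vertexAt)

  vertexSum-* : ∀ c g → vertexSum (λ v → c * g v) ≡ c * vertexSum g
  vertexSum-* c g = sym (*-distribˡ-sum c (g ∘ vertexAt))

  vertexSum-zero : ∀ g → (∀ v → g v ≡ 0ℤ) → vertexSum g ≡ 0ℤ
  vertexSum-zero g eq = trans (vertexSum-cong eq) (∑-zero (order Γ))

  -- Serves to select, among all the copies in a corona, the one attached to `u`.
  vertexSum-δ : ∀ u g → vertexSum (λ v → ι (_≟ⱽ_ Γ u v) * g v) ≡ g u
  vertexSum-δ u g = begin
    vertexSum (λ v → ι (_≟ⱽ_ Γ u v) * g v)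
      ≡⟨ sum-cong-≗ (λ i → cong (_* g (vertexAt i)) (ι-cong (_≟ⱽ_ Γ u (vertexAt i)) (index Γ u Fin.≟ i)
           (λ { refl → Inverse.strictlyInverseˡ (enum Γ) i })
           (λ { refl → sym (Inverse.strictlyInverseʳ (enum Γ) u) }))) ⟩
    ∑[ i < order Γ ] (ι (index Γ u Fin.≟ i) * g (vertexAt i))
      ≡⟨ ∑-δ (index Γ u) (g ∘ vertexAt) ⟩
    g (vertexAt (index Γ u))
      ≡⟨ cong g (Inverse.strictlyInverseʳ (enum Γ) u) ⟩
    g u ∎
    where open ≡-Reasoning

  sumOver-vertices : ∀ g → sumOver (vertices Γ) g ≡ vertexSum g
  sumOver-vertices g =
    trans (sumOver-map vertexAt (allFin (order Γ)) g) (sumOver-tabulate (order Γ) _ (g ∘ vertexAt))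

  sumOver-edges : ∀ w → sumOver (edges Γ) (uncurry w) ≡ edgeSum w
  sumOver-edges w = begin
    sumOver (edges Γ) (uncurry w)
      ≡⟨ sumOver-filter (uncurry edge?) (cartesianProduct (vertices Γ) (vertices Γ)) (uncurry w) ⟩
    sumOver (cartesianProduct (vertices Γ) (vertices Γ)) (uncurry w′)
      ≡⟨ sumOver-cartesianProduct (vertices Γ) (vertices Γ) (uncurry w′) ⟩
    sumOver (vertices Γ) (λ u → sumOver (vertices Γ) (w′ u))
      ≡⟨ sumOver-cong (vertices Γ) (λ u → sumOver-vertices (w′ u)) ⟩
    sumOver (vertices Γ) (λ u → vertexSum (w′ u))
      ≡⟨ sumOver-vertices (λ u → vertexSum (w′ u)) ⟩
    edgeSum w ∎
    where
    open ≡-Reasoning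
    w′ : V Γ → V Γ → ℤ
    w′ u v = edgeIndicator u v * w u v

  size-edgeSum : + size Γ ≡ edgeSum (λ _ _ → 1ℤ)
  size-edgeSum = trans (length-sumOver (edges Γ)) (sumOver-edges (λ _ _ → 1ℤ))

-- Induction by peeling off vertex 0. Its row holds only the edge to vertex 1, its column is empty
-- because an edge is listed from its smaller end, and what remains is the edge matrix of a path
-- with one vertex fewer.
edgeSum-path : ∀ m w → edgeSum (path (suc m)) w ≡ ∑[ i < m ] w (inject₁ i) (suc i)
edgeSum-path zero    w = refl
edgeSum-path (suc m) w = begin
  -- The factors 0 and 1 in the first row are what the indicators at (0 , 0) and (0 , 1) compute to.
  (0ℤ * w zero zero + (1ℤ * w zero (suc zero) + ∑[ j < m ] (E zero (suc (suc j)) * w zero (suc (suc j)))))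
    + ∑[ i < suc m ] (E (suc i) zero * w (suc i) zero + ∑[ j < suc m ] (E (suc i) (suc j) * w (suc i) (suc j)))
    ≡⟨ cong₂ _+_ firstRow (sum-cong-≗ laterRow) ⟩
  w zero (suc zero) + edgeSum (path (suc m)) (λ i j → w (suc i) (suc j))
    ≡⟨ cong (_+_ (w zero (suc zero))) (edgeSum-path m (λ i j → w (suc i) (suc j))) ⟩
  w zero (suc zero) + ∑[ i < m ] w (suc (inject₁ i)) (suc (suc i)) ∎
  where
  open ≡-Reasoning
  E : Fin (suc (suc m)) → Fin (suc (suc m)) → ℤ
  E = edgeIndicator (path (suc (suc m)))

  E-far : ∀ j → E zero (suc (suc j)) ≡ 0ℤ
  E-far j = ι-no (edge? (path (suc (suc m))) zero (suc (suc j))) λ { (_ , inj₁ ()) ; (_ , inj₂ ()) }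

  E-suc : ∀ i j → E (suc i) (suc j) ≡ edgeIndicator (path (suc m)) i j
  E-suc i j = ι-cong (edge? (path (suc (suc m))) (suc i) (suc j)) (edge? (path (suc m)) i j)
    (λ { (s≤s lt , inj₁ eq) → lt , inj₁ (ℕ.suc-injective eq)
       ; (s≤s lt , inj₂ eq) → lt , inj₂ (ℕ.suc-injective eq) })
    (λ { (lt , inj₁ eq) → s≤s lt , inj₁ (cong suc eq)
       ; (lt , inj₂ eq) → s≤s lt , inj₂ (cong suc eq) })

  E-back : ∀ i → E (suc i) zero ≡ 0ℤ
  E-back i = ι-no (edge? (path (suc (suc m))) (suc i) zero) λ { (() , _) }

  firstRow : 0ℤ * w zero zero + (1ℤ * w zero (suc zero) + ∑[ j < m ] (E zero (suc (suc j)) * w zero (suc (suc j))))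
             ≡ w zero (suc zero)
  firstRow = trans
    (cong (λ s → 0ℤ * w zero zero + (1ℤ * w zero (suc zero) + s))
      (trans (sum-cong-≗ λ j → cong (_* w zero (suc (suc j))) (E-far j)) (∑-zero m)))
    (collapse (w zero zero) (w zero (suc zero)))
    where
    collapse : ∀ a b → 0ℤ * a + (1ℤ * b + 0ℤ) ≡ b
    collapse = solve-∀

  laterRow : ∀ i → E (suc i) zero * w (suc i) zero + ∑[ j < suc m ] (E (suc i) (suc j) * w (suc i) (suc j))
             ≡ ∑[ j < suc m ] (edgeIndicator (path (suc m)) i j * w (suc i) (suc j))
  laterRow i = trans
    (cong₂ _+_ (cong (_* w (suc i) zero) (E-back i))
      (sum-cong-≗ λ j → cong (_* w (suc i) (suc j)) (E-suc i j)))
    (ℤ.+-identityˡ _)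

-- Edge sums, connectivity and the block labeling of a corona.

module _ (G H : Graph) where

  private
    E : CoronaV G H → CoronaV G H → ℤ
    E = edgeIndicator (corona G H)

  -- The enumeration of the corona lists the base vertices first and then the copies, one after
  -- another in the order of their owners. `∑-↑` separates these two ranges and `∑-combine` cuts the
  -- second into copies.
  vertexSum-corona : ∀ g → vertexSum (corona G H) g ≡
    vertexSum G (g ∘ inj₁) + vertexSum G (λ u → vertexSum H (λ x → g (inj₂ (u , x))))
  vertexSum-corona g = trans (∑-↑ (order G) (g ∘ vertexAt (corona G H)))
    (cong₂ _+_ (sum-cong-≗ λ i → cong g (at-base i))
      (trans (∑-combine (order G) _) (sum-cong-≗ λ i → sum-cong-≗ λ j → cong g (at-copy i j))))
    where
    at-base : ∀ i → vertexAt (corona G H) (i ↑ˡ (order G ℕ.* order H)) ≡ inj₁ (vertexAt G i)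
    at-base i rewrite Fin.splitAt-↑ˡ (order G) i (order G ℕ.* order H) = refl

    at-copy : ∀ i j → vertexAt (corona G H) (order G ↑ʳ combine i j) ≡ inj₂ (vertexAt G i , vertexAt H j)
    at-copy i j rewrite Fin.splitAt-↑ʳ (order G) (order G ℕ.* order H) (combine i j) =
      cong (λ (i , j) → inj₂ (vertexAt G i , vertexAt H j)) (Fin.remQuot-combine i j)

  toℕ-index-base : ∀ u → toℕ (index (corona G H) (inj₁ u)) ≡ toℕ (index G u)
  toℕ-index-base u = Fin.toℕ-↑ˡ (index G u) (order G ℕ.* order H)

  toℕ-index-copy : ∀ u x → toℕ (index (corona G H) (inj₂ (u , x))) ≡
                   order G ℕ.+ (order H ℕ.* toℕ (index G u) ℕ.+ toℕ (index H x))
  toℕ-index-copy u x = trans (Fin.toℕ-↑ʳ (order G) (combine (index G u) (index H x)))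
    (cong (order G ℕ.+_) (Fin.toℕ-combine (index G u) (index H x)))

  -- Hence an edge between a base vertex and its copy is listed only from the base end.
  base<copy : ∀ u v x → index (corona G H) (inj₁ u) Fin.< index (corona G H) (inj₂ (v , x))
  base<copy u v x rewrite toℕ-index-base u | toℕ-index-copy v x =
    ℕ.<-≤-trans (Fin.toℕ<n (index G u)) (ℕ.m≤m+n (order G) _)

  E-base-base : ∀ u v → E (inj₁ u) (inj₁ v) ≡ edgeIndicator G u v
  E-base-base u v = ι-cong (edge? (corona G H) (inj₁ u) (inj₁ v)) (edge? G u v)
    (λ (lt , adj) → subst₂-< (toℕ-index-base u) (toℕ-index-base v) lt , adj)
    (λ (lt , adj) → subst₂-< (sym (toℕ-index-base u)) (sym (toℕ-index-base v)) lt , adj)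
    where
    subst₂-< : ∀ {a b c d} → a ≡ b → c ≡ d → a ℕ.< c → b ℕ.< d
    subst₂-< refl refl lt = lt

  E-base-copy : ∀ u v x → E (inj₁ u) (inj₂ (v , x)) ≡ ι (_≟ⱽ_ G u v)
  E-base-copy u v x =
    ι-cong (edge? (corona G H) (inj₁ u) (inj₂ (v , x))) (_≟ⱽ_ G u v) proj₂ (base<copy u v x ,_)

  E-copy-base : ∀ u x v → E (inj₂ (u , x)) (inj₁ v) ≡ 0ℤ
  E-copy-base u x v = ι-no (edge? (corona G H) (inj₂ (u , x)) (inj₁ v)) λ (lt , _) → ℕ.<-asym lt (base<copy v u x)

  -- Once the owners are identified, both indices carry the same offset
  -- `order G + order H * index G u`, and cancelling it turns the order of the corona into the order
  -- of `H`.
  E-copy-copy : ∀ u x v y → E (inj₂ (u , x)) (inj₂ (v , y)) ≡ ι (_≟ⱽ_ G u v) * edgeIndicator H x y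
  E-copy-copy u x v y = trans
    (ι-cong (edge? (corona G H) (inj₂ (u , x)) (inj₂ (v , y))) (_≟ⱽ_ G u v ×-dec edge? H x y)
      (λ { (lt , refl , adj) → refl , cancel lt , adj })
      (λ { (refl , lt , adj) → uncancel lt , refl , adj }))
    (ι-× (_≟ⱽ_ G u v) (edge? H x y))
    where
    cancel : ∀ {u x y} → index (corona G H) (inj₂ (u , x)) Fin.< index (corona G H) (inj₂ (u , y)) →
             index H x Fin.< index H y
    cancel {u} {x} {y} lt rewrite toℕ-index-copy u x | toℕ-index-copy u y =
      ℕ.+-cancelˡ-< (order H ℕ.* toℕ (index G u)) _ _ (ℕ.+-cancelˡ-< (order G) _ _ lt)

    uncancel : ∀ {u x y} → index H x Fin.< index H y →
               index (corona G H) (inj₂ (u , x)) Fin.< index (corona G H) (inj₂ (u , y))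
    uncancel {u} {x} {y} lt rewrite toℕ-index-copy u x | toℕ-index-copy u y =
      ℕ.+-monoʳ-< (order G) (ℕ.+-monoʳ-< (order H ℕ.* toℕ (index G u)) lt)

  -- The row of a base vertex splits into edges of `G` and edges to its own copy; the row of a copy
  -- vertex has no base part and stays within its copy. In both cases the sum over owners collapses
  -- by `vertexSum-δ`.
  edgeSum-corona : ∀ w → edgeSum (corona G H) w ≡
    edgeSum G (λ u v → w (inj₁ u) (inj₁ v)) +
    vertexSum G (λ u → vertexSum H (λ x → w (inj₁ u) (inj₂ (u , x))) +
                       edgeSum H (λ x y → w (inj₂ (u , x)) (inj₂ (u , y))))
  edgeSum-corona w = begin
    edgeSum (corona G H) w
      ≡⟨ vertexSum-corona row ⟩
    vertexSum G (λ u → row (inj₁ u)) + vertexSum G (λ u → vertexSum H (λ x → row (inj₂ (u , x))))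
      ≡⟨ cong₂ _+_ (vertexSum-cong G row-base) (vertexSum-cong G λ u → vertexSum-cong H (row-copy u)) ⟩
    vertexSum G (λ u → base u + star u) + vertexSum G copy
      ≡⟨ cong (_+ vertexSum G copy) (vertexSum-+ G base star) ⟩
    (vertexSum G base + vertexSum G star) + vertexSum G copy
      ≡⟨ ℤ.+-assoc (vertexSum G base) _ _ ⟩
    vertexSum G base + (vertexSum G star + vertexSum G copy)
      ≡⟨ cong (_+_ (vertexSum G base)) (sym (vertexSum-+ G star copy)) ⟩
    vertexSum G base + vertexSum G (λ u → star u + copy u) ∎
    where
    open ≡-Reasoning
    row : CoronaV G H → ℤ
    row s = vertexSum (corona G H) (λ t → E s t * w s t)

    base star copy : V G → ℤ
    base u = vertexSum G (λ v → edgeIndicator G u v * w (inj₁ u) (inj₁ v))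
    star u = vertexSum H (λ x → w (inj₁ u) (inj₂ (u , x)))
    copy u = edgeSum H (λ x y → w (inj₂ (u , x)) (inj₂ (u , y)))

    row-base : ∀ u → row (inj₁ u) ≡ base u + star u
    row-base u = trans (vertexSum-corona (λ t → E (inj₁ u) t * w (inj₁ u) t)) (cong₂ _+_
      (vertexSum-cong G λ v → cong (_* w (inj₁ u) (inj₁ v)) (E-base-base u v))
      (trans
        (vertexSum-cong G λ v → trans
          (vertexSum-cong H λ x → cong (_* w (inj₁ u) (inj₂ (v , x))) (E-base-copy u v x))
          (vertexSum-* H (ι (_≟ⱽ_ G u v)) (λ x → w (inj₁ u) (inj₂ (v , x)))))
        (vertexSum-δ G u (λ v → vertexSum H (λ x → w (inj₁ u) (inj₂ (v , x)))))))

    row-copy : ∀ u x → row (inj₂ (u , x)) ≡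
               vertexSum H (λ y → edgeIndicator H x y * w (inj₂ (u , x)) (inj₂ (u , y)))
    row-copy u x = trans (vertexSum-corona (λ t → E (inj₂ (u , x)) t * w (inj₂ (u , x)) t)) (trans (cong₂ _+_
      (vertexSum-zero G (λ v → E (inj₂ (u , x)) (inj₁ v) * w (inj₂ (u , x)) (inj₁ v)) λ v →
        trans (cong (_* w (inj₂ (u , x)) (inj₁ v)) (E-copy-base u x v))
              (ℤ.*-zeroˡ (w (inj₂ (u , x)) (inj₁ v))))
      (trans
        (vertexSum-cong G λ v → trans
          (vertexSum-cong H λ y → trans
            (cong (_* w (inj₂ (u , x)) (inj₂ (v , y))) (E-copy-copy u x v y))
            -- Regrouping exposes the owner indicator as a factor independent of `y`, which can
            -- leave the inner sum.
            (ℤ.*-assoc (ι (_≟ⱽ_ G u v)) (edgeIndicator H x y) _))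
          (vertexSum-* H (ι (_≟ⱽ_ G u v)) (λ y → edgeIndicator H x y * w (inj₂ (u , x)) (inj₂ (v , y)))))
        (vertexSum-δ G u (λ v → vertexSum H (λ y → edgeIndicator H x y * w (inj₂ (u , x)) (inj₂ (v , y)))))))
      (ℤ.+-identityˡ _))

  -- Each copy vertex is adjacent to its owner, so any two vertices are joined by a walk through
  -- `G`.
  corona-connected : Connected G → Connected (corona G H)
  corona-connected (v₀ , conn) = inj₁ v₀ , connected
    where
    bases : ∀ u v → Star (CoronaAdj G H) (inj₁ u) (inj₁ v)
    bases u v = Star.gmap inj₁ (λ adj → adj) (conn u v)

    connected : ∀ s t → Star (CoronaAdj G H) s t
    connected (inj₁ u)       (inj₁ v)       = bases u v
    connected (inj₁ u)       (inj₂ (v , y)) = bases u v ◅◅ (refl ◅ Star.ε)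
    connected (inj₂ (u , x)) (inj₁ v)       = refl ◅ bases u v
    connected (inj₂ (u , x)) (inj₂ (v , y)) = refl ◅ (bases u v ◅◅ (refl ◅ Star.ε))

  -- Unlike the enumeration of the corona, this interleaves: a base vertex and its copy fill one
  -- block of `suc (order H)` consecutive labels, the base vertex first. The cast reconciles the
  -- number of labels counted by blocks with the order of the corona.
  blockLabeling : V (corona G H) ⤖ Fin (order (corona G H))
  blockLabeling = ↔⇒⤖
    (cast↔ ↔-∘ (↔-sym Fin.*↔× ↔-∘ ((enum G ×-↔ ↔-id _) ↔-∘ blocks)))
    where
    cast↔ : Fin (order G ℕ.* suc (order H)) ↔ Fin (order G ℕ.+ order G ℕ.* order H)
    cast↔ = mk↔ₛ′ (cast eq) (cast (sym eq)) (Fin.cast-involutive eq (sym eq)) (Fin.cast-involutive (sym eq) eq)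
      where
      eq : order G ℕ.* suc (order H) ≡ order G ℕ.+ order G ℕ.* order H
      eq = ℕ.*-suc (order G) (order H)

    blocks : V (corona G H) ↔ (V G × Fin (suc (order H)))
    blocks = mk↔ₛ′
      (λ { (inj₁ u) → u , zero ; (inj₂ (u , x)) → u , suc (index H x) })
      (λ { (u , zero) → inj₁ u ; (u , suc i) → inj₂ (u , vertexAt H i) })
      (λ { (u , zero) → refl ; (u , suc i) → cong (λ j → u , suc j) (Inverse.strictlyInverseˡ (enum H) i) })
      (λ { (inj₁ u) → refl ; (inj₂ (u , x)) → cong (λ y → inj₂ (u , y)) (Inverse.strictlyInverseʳ (enum H) x) })

  blockLabeling-base : ∀ u → toℕ (Bijection.to blockLabeling (inj₁ u)) ≡
                       suc (order H) ℕ.* toℕ (index G u) ℕ.+ 0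
  blockLabeling-base u = trans (Fin.toℕ-cast _ _) (Fin.toℕ-combine (index G u) zero)

  blockLabeling-copy : ∀ u x → toℕ (Bijection.to blockLabeling (inj₂ (u , x))) ≡
                       suc (order H) ℕ.* toℕ (index G u) ℕ.+ suc (toℕ (index H x))
  blockLabeling-copy u x = trans (Fin.toℕ-cast _ _) (Fin.toℕ-combine (index G u) (suc (index H x)))

-- Contribution of one copy as sums over a period.

module _ (r : ℕ → ℤ) (m : ℕ) (r₀ : r 0 ≡ 1ℤ) where

  private
    R : ℤ
    R = ∑[ i < suc (suc m) ] r (toℕ i)

  -- The star edges see the whole period except index 0, at which `r` is 1.
  star-sum : ∑[ x < suc m ] r (suc (toℕ x)) ≡ R - 1ℤ
  star-sum = trans (cancel S) (cong (λ a → (a + S) - 1ℤ) (sym r₀))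
    where
    S : ℤ
    S = ∑[ x < suc m ] r (suc (toℕ x))

    cancel : ∀ s → s ≡ (1ℤ + s) - 1ℤ
    cancel = solve-∀

  -- With r j = τ (F_j) and π = m + 2: the path edges see the period F₁ , … , F_π
  -- without F₁ and F₂, at each of which r is −1.
  path-sum : r 1 ≡ -1ℤ → r 2 ≡ -1ℤ → r (2 ℕ.+ m) ≡ 1ℤ → ∑[ x < m ] r (3 ℕ.+ toℕ x) ≡ R + + 2
  path-sum r₁ r₂ r-last = begin
    T
      ≡⟨ expand T ⟩
    -- Adding `r 0`, `r 1` and `r 2`, of total -1, completes `T` to the sum over the indices 0 to
    -- `m + 2`, one term more than `R`; the outer 1 compensates.
    (1ℤ + (-1ℤ + (-1ℤ + T))) + 1ℤ
      ≡⟨ cong (_+ 1ℤ) (cong₂ _+_ r₀ (cong₂ _+_ r₁ (cong (_+ T) r₂))) ⟨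
    ∑[ i < 3 ℕ.+ m ] r (toℕ i) + 1ℤ
      ≡⟨ cong (_+ 1ℤ) (sum-init-last {suc (suc m)} (λ i → r (toℕ i))) ⟩
    (∑[ i < 2 ℕ.+ m ] r (toℕ (inject₁ i)) + r (toℕ (Fin.fromℕ (2 ℕ.+ m)))) + 1ℤ
      ≡⟨ cong (_+ 1ℤ) (cong₂ _+_ (sum-cong-≗ {2 ℕ.+ m} (λ i → cong r (Fin.toℕ-inject₁ i)))
           (trans (cong r (Fin.toℕ-fromℕ (2 ℕ.+ m))) r-last)) ⟩
    (R + 1ℤ) + 1ℤ
      ≡⟨ ℤ.+-assoc R 1ℤ 1ℤ ⟩
    R + + 2 ∎
    where
    open ≡-Reasoning
    T : ℤ
    T = ∑[ x < m ] r (3 ℕ.+ toℕ x)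

    expand : ∀ t → t ≡ (1ℤ + (-1ℤ + (-1ℤ + t))) + 1ℤ
    expand = solve-∀

-- Legendre symbols, edge signs and periods modulo an odd prime.

module _ (P : OddPrime) where

  ∣-resp-≡mod : ∀ {x y} → x ≡ y [mod val P ] → + val P ∣ x → + val P ∣ y
  ∣-resp-≡mod {x} {y} x≡y p∣x = subst (+ val P ∣_) (lemma x y) (∣m∣n⇒∣m-n p∣x x≡y)
    where
    lemma : ∀ x y → x - (x - y) ≡ y
    lemma = solve-∀

  legendre-cong : ∀ {x y} → x ≡ y [mod val P ] → legendre P x ≡ legendre P y
  legendre-cong {x} {y} x≡y
    with + val P ∣? x | isSquareMod? P x | + val P ∣? y | isSquareMod? P y
  ... | yes _   | _       | yes _   | _       = refl
  ... | yes p∣x | _       | no p∤y  | _       = contradiction (∣-resp-≡mod {x} {y} x≡y p∣x) p∤y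
  ... | no p∤x  | _       | yes p∣y | _       = contradiction (∣-resp-≡mod {y} {x} (≡mod-sym {x = x} x≡y) p∣y) p∤x
  ... | no _    | yes _   | no _    | yes _   = refl
  ... | no _    | yes (r , r²≡x) | no _ | no ¬□y = contradiction (r , ≡mod-trans {x = r * r} r²≡x x≡y) ¬□y
  ... | no _    | no ¬□x  | no _ | yes (r , r²≡y) =
    contradiction (r , ≡mod-trans {x = r * r} {y = y} r²≡y (≡mod-sym {x = x} x≡y)) ¬□x
  ... | no _    | no _    | no _    | no _    = refl

  private
    sgn : ℤ → ℤ
    sgn l = ι (l ℤ.≟ 0ℤ) - ι (l ℤ.≟ 1ℤ)

  -- Outside this block `τ` is used only through the lemmas proved here, so later goals need not
  -- unfold into the divisibility and square tests.
  opaque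
    -- +1 on the values whose edge label is 0, −1 on those whose edge label is 1.
    τ : ℤ → ℤ
    τ z = 1ℤ - + 2 * ι (legendre P z ℤ.≟ 1ℤ)

    τ-cong : ∀ {x y} → x ≡ y [mod val P ] → τ x ≡ τ y
    τ-cong {x} {y} x≡y = cong (λ l → 1ℤ - + 2 * ι (l ℤ.≟ 1ℤ)) (legendre-cong {x} {y} x≡y)

    τ-zero : τ 0ℤ ≡ 1ℤ
    τ-zero with + val P ∣? 0ℤ | isSquareMod? P 0ℤ
    ... | yes _  | _ = refl
    ... | no p∤0 | _ = contradiction (≡mod-reflexive {x = 0ℤ} refl) p∤0

    τ-square : ∀ {z} → legendre P z ≡ 1ℤ → τ z ≡ -1ℤ
    τ-square eq = cong (λ l → 1ℤ - + 2 * ι (l ℤ.≟ 1ℤ)) eq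

    -- The count defining a PL prime puts symbol 0 together with symbol -1, exactly as edge labels
    -- do. This is what links `k` to the label imbalance.
    τ-legendre : ∀ z → (ι (legendre P z ℤ.≟ 1ℤ) - ι (legendre P z ℤ.≟ -1ℤ)) - ι (legendre P z ℤ.≟ 0ℤ) ≡ -1ℤ * τ z
    τ-legendre z with + val P ∣? z | isSquareMod? P z
    ... | yes _ | _     = refl
    ... | no _  | yes _ = refl
    ... | no _  | no _  = refl

    -- Symbol 0 gets label 0 by the separate clause, symbol -1 gets (1 - 1) / 2 = 0 and symbol 1
    -- gets (1 + 1) / 2 = 1, all by evaluation. The label tests whether `val P` divides s - 0 and
    -- the symbol whether it divides s, so the mixed cases are contradictory.
    sgn-inducedLabel : ∀ a b Γ f u v →
      sgn (inducedLabel a b P Γ f u v) ≡ τ (endpointSum a b P Γ f u v)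
    sgn-inducedLabel a b Γ f u v
      with endpointSum a b P Γ f u v ≡? 0ℤ [mod val P ]
    sgn-inducedLabel a b Γ f u v | yes s≡0
      with + val P ∣? endpointSum a b P Γ f u v | isSquareMod? P (endpointSum a b P Γ f u v)
    ... | yes _  | _     = refl
    ... | no p∤s | _     = contradiction (subst (+ val P ∣_) (ℤ.+-identityʳ _) s≡0) p∤s
    sgn-inducedLabel a b Γ f u v | no s≢0
      with + val P ∣? endpointSum a b P Γ f u v | isSquareMod? P (endpointSum a b P Γ f u v)
    ... | yes p∣s | _     = contradiction (subst (+ val P ∣_) (sym (ℤ.+-identityʳ _)) p∣s) s≢0
    ... | no _    | yes _ = refl
    ... | no _    | no _  = refl

  labelImbalance : ∀ a b Γ f →
    + e a b P Γ f 0ℤ - + e a b P Γ f 1ℤ ≡ edgeSum Γ (λ u v → τ (endpointSum a b P Γ f u v))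
  labelImbalance a b Γ f = begin
    + e a b P Γ f 0ℤ - + e a b P Γ f 1ℤ
      ≡⟨ cong₂ _-_ (length-filter (λ (u , v) → label u v ℤ.≟ 0ℤ) (edges Γ))
                   (length-filter (λ (u , v) → label u v ℤ.≟ 1ℤ) (edges Γ)) ⟩
    sumOver (edges Γ) (λ (u , v) → ι (label u v ℤ.≟ 0ℤ)) - sumOver (edges Γ) (λ (u , v) → ι (label u v ℤ.≟ 1ℤ))
      ≡⟨ sumOver-- (edges Γ) (λ (u , v) → ι (label u v ℤ.≟ 0ℤ)) (λ (u , v) → ι (label u v ℤ.≟ 1ℤ)) ⟩
    sumOver (edges Γ) (λ (u , v) → sgn (label u v))
      ≡⟨ sumOver-edges Γ (λ u v → sgn (label u v)) ⟩
    edgeSum Γ (λ u v → sgn (label u v))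
      ≡⟨ edgeSum-cong Γ (sgn-inducedLabel a b Γ f) ⟩
    edgeSum Γ (λ u v → τ (endpointSum a b P Γ f u v)) ∎
    where
    open ≡-Reasoning
    label : V Γ → V Γ → ℤ
    label = inducedLabel a b P Γ f

  -- With `g` the sequence and `n` its Pisano period, the left side is the unfolded right side of
  -- `IsPLPrime`.
  quadraticExcess : ∀ (g : ℕ → ℤ) n →
    (+ length (filter (λ ξ → legendre P (g ξ) ℤ.≟ 1ℤ) (upTo n))
      - + length (filter (λ ξ → legendre P (g ξ) ℤ.≟ -1ℤ) (upTo n)))
      - + length (filter (λ ξ → legendre P (g ξ) ℤ.≟ 0ℤ) (upTo n))
    ≡ -1ℤ * ∑[ i < n ] τ (g (toℕ i))
  quadraticExcess g n = begin
    (+ length (filter (has? 1ℤ) (upTo n)) - + length (filter (has? -1ℤ) (upTo n)))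
      - + length (filter (has? 0ℤ) (upTo n))
      ≡⟨ cong₂ _-_ (cong₂ _-_ (length-filter (has? 1ℤ) (upTo n)) (length-filter (has? -1ℤ) (upTo n)))
                   (length-filter (has? 0ℤ) (upTo n)) ⟩
    (sumOver (upTo n) (ι ∘ has? 1ℤ) - sumOver (upTo n) (ι ∘ has? -1ℤ)) - sumOver (upTo n) (ι ∘ has? 0ℤ)
      ≡⟨ cong (_- sumOver (upTo n) (ι ∘ has? 0ℤ)) (sumOver-- (upTo n) (ι ∘ has? 1ℤ) (ι ∘ has? -1ℤ)) ⟩
    sumOver (upTo n) (λ ξ → ι (has? 1ℤ ξ) - ι (has? -1ℤ ξ)) - sumOver (upTo n) (ι ∘ has? 0ℤ)
      ≡⟨ sumOver-- (upTo n) (λ ξ → ι (has? 1ℤ ξ) - ι (has? -1ℤ ξ)) (ι ∘ has? 0ℤ) ⟩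
    sumOver (upTo n) (λ ξ → (ι (has? 1ℤ ξ) - ι (has? -1ℤ ξ)) - ι (has? 0ℤ ξ))
      ≡⟨ sumOver-cong (upTo n) (λ ξ → τ-legendre (g ξ)) ⟩
    sumOver (upTo n) (λ ξ → -1ℤ * τ (g ξ))
      ≡⟨ sumOver-applyUpTo n (λ ξ → ξ) (λ ξ → -1ℤ * τ (g ξ)) ⟩
    ∑[ i < n ] (-1ℤ * τ (g (toℕ i)))
      ≡⟨ *-distribˡ-sum {n} -1ℤ (λ i → τ (g (toℕ i))) ⟨
    -1ℤ * ∑[ i < n ] τ (g (toℕ i)) ∎
    where
    open ≡-Reasoning
    has? : ∀ j ξ → Dec (legendre P (g ξ) ≡ j)
    has? j ξ = legendre P (g ξ) ℤ.≟ j

  isPLPrime-∑ : ∀ k a b → IsPLPrime k a b P → k ≡ -1ℤ * ∑[ i < π a b P ] τ (F a b (toℕ i))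
  isPLPrime-∑ k a b isPL = trans isPL (quadraticExcess (F a b) (π a b P))

  -- The index has the shape `t * q + n` of a block label: `q` is the block and `n` the position in
  -- it.
  F-period : ∀ {a b t} → IsPeriod a b P t → ∀ q n → F a b (t ℕ.* q ℕ.+ n) ≡ F a b n [mod val P ]
  F-period {a} {b} {t} period zero n rewrite ℕ.*-zeroʳ t = ≡mod-reflexive {x = F a b n} refl
  F-period {a} {b} {t} period@(_ , shift) (suc q) n =
    ≡mod-trans {x = F a b (t ℕ.* suc q ℕ.+ n)} {y = F a b (t ℕ.* q ℕ.+ n)}
      (subst (λ i → F a b i ≡ F a b (t ℕ.* q ℕ.+ n) [mod val P ]) eq (shift (t ℕ.* q ℕ.+ n)))
      (F-period period q n)
    where
    eq : t ℕ.* q ℕ.+ n ℕ.+ t ≡ t ℕ.* suc q ℕ.+ n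
    eq = trans (ℕ.+-comm _ t) (trans (sym (ℕ.+-assoc t _ n)) (cong (ℕ._+ n) (sym (ℕ.*-suc t q))))

  legendre≡1⇒p∤ : ∀ {z} → legendre P z ≡ 1ℤ → ¬ (+ val P ∣ z)
  legendre≡1⇒p∤ {z} eq p∣z with + val P ∣? z | isSquareMod? P z
  legendre≡1⇒p∤ () _ | yes _ | _
  ... | no p∤z | _ = p∤z p∣z

  -- Period 1 would give b = F₁ ≡ F₀ = 0, hence symbol 0. This secures a period of the form `m + 2`.
  period≢1 : ∀ {b} → legendre P b ≡ 1ℤ → ¬ IsPeriod 0ℤ b P 1
  period≢1 {b} □b (_ , shift) = legendre≡1⇒p∤ □b (subst (+ val P ∣_) (ℤ.+-identityʳ b) (shift 0))

  -- Label imbalance of the corona with a path under the block labeling.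

  module _ (b : ℤ) (m : ℕ) (period : IsPeriod 0ℤ b P (suc (suc m)))
           (□F₁ : legendre P (F 0ℤ b 1) ≡ 1ℤ) (□F₂ : legendre P (F 0ℤ b 2) ≡ 1ℤ) where

    private
      r : ℕ → ℤ
      r j = τ (F 0ℤ b j)

      R : ℤ
      R = ∑[ i < suc (suc m) ] r (toℕ i)

    module _ (G : Graph) where

      private
        H : Graph
        H = path (suc m)

        f : V (corona G H) ⤖ Fin (order (corona G H))
        f = blockLabeling G H

        w : V (corona G H) → V (corona G H) → ℤ
        w s t = τ (endpointSum 0ℤ b P (corona G H) f s t)

        fib : V (corona G H) → ℤ
        fib s = F 0ℤ b (toℕ (Bijection.to f s))

      -- A block has `suc (order H)` = `m + 2` labels, which is the period, so only the position
      -- inside the block matters.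
      fib-base : ∀ u → fib (inj₁ u) ≡ F 0ℤ b 0 [mod val P ]
      fib-base u rewrite blockLabeling-base G H u = F-period period (toℕ (index G u)) 0

      fib-copy : ∀ u x → fib (inj₂ (u , x)) ≡ F 0ℤ b (suc (toℕ x)) [mod val P ]
      fib-copy u x rewrite blockLabeling-copy G H u x = F-period period (toℕ (index G u)) (suc (toℕ x))

      w-base : ∀ u v → w (inj₁ u) (inj₁ v) ≡ 1ℤ
      w-base u v = trans
        (τ-cong {fib (inj₁ u) + fib (inj₁ v)} {0ℤ}
          (≡mod-+ {x = fib (inj₁ u)} {0ℤ} {fib (inj₁ v)} {0ℤ} (fib-base u) (fib-base v)))
        τ-zero

      w-star : ∀ u x → w (inj₁ u) (inj₂ (u , x)) ≡ r (suc (toℕ x))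
      w-star u x = trans
        (τ-cong {fib (inj₁ u) + fib (inj₂ (u , x))} {0ℤ + F 0ℤ b (suc (toℕ x))}
          (≡mod-+ {x = fib (inj₁ u)} {0ℤ} {fib (inj₂ (u , x))} (fib-base u) (fib-copy u x)))
        (cong τ (ℤ.+-identityˡ _))

      w-path : ∀ u (i : Fin m) → w (inj₂ (u , inject₁ i)) (inj₂ (u , suc i)) ≡ r (3 ℕ.+ toℕ i)
      w-path u i = trans
        (τ-cong {fib s + fib t} {F 0ℤ b (suc (toℕ (inject₁ i))) + F 0ℤ b (2 ℕ.+ toℕ i)}
          (≡mod-+ {x = fib s} {_} {fib t} (fib-copy u (inject₁ i)) (fib-copy u (suc i))))
        (cong τ (trans (cong (λ j → F 0ℤ b (suc j) + F 0ℤ b (2 ℕ.+ toℕ i)) (Fin.toℕ-inject₁ i))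
                       -- The recurrence puts the larger index first; after the swap the sum is the
                       -- term of index `3 + i` by definition.
                       (ℤ.+-comm (F 0ℤ b (suc (toℕ i))) _)))
        where
        s t : V (corona G H)
        s = inj₂ (u , inject₁ i)
        t = inj₂ (u , suc i)

      labelImbalance-corona : + e 0ℤ b P (corona G H) f 0ℤ - + e 0ℤ b P (corona G H) f 1ℤ ≡
                              + size G + + order G * ((R - 1ℤ) + (R + + 2))
      labelImbalance-corona = begin
        + e 0ℤ b P (corona G H) f 0ℤ - + e 0ℤ b P (corona G H) f 1ℤ
          ≡⟨ labelImbalance 0ℤ b (corona G H) f ⟩
        edgeSum (corona G H) w
          ≡⟨ edgeSum-corona G H w ⟩
        edgeSum G (λ u v → w (inj₁ u) (inj₁ v)) + vertexSum G perCopy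
          ≡⟨ cong₂ _+_ (trans (edgeSum-cong G w-base) (sym (size-edgeSum G)))
                       (trans (vertexSum-cong G perCopy≡) (∑-const (order G) _)) ⟩
        + size G + + order G * ((R - 1ℤ) + (R + + 2)) ∎
        where
        open ≡-Reasoning
        perCopy : V G → ℤ
        perCopy u = vertexSum H (λ x → w (inj₁ u) (inj₂ (u , x))) +
                    edgeSum H (λ x y → w (inj₂ (u , x)) (inj₂ (u , y)))

        perCopy≡ : ∀ u → perCopy u ≡ (R - 1ℤ) + (R + + 2)
        perCopy≡ u = cong₂ _+_
          (trans (sum-cong-≗ (w-star u)) (star-sum r m τ-zero))
          (trans (edgeSum-path m (λ x y → w (inj₂ (u , x)) (inj₂ (u , y)))) (trans (sum-cong-≗ (w-path u))
            -- `proj₂ period 0` says that the term of index `m + 2` is congruent to F₀ = 0, so the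
            -- last path edge has sign 1.
            (path-sum r m τ-zero (τ-square □F₁) (τ-square □F₂) (trans (τ-cong (proj₂ period 0)) τ-zero))))

      -- With k = -R, the term n(2k - 1) of the size cancels the n(2R + 1) coming from the copies,
      -- and the imbalance is exactly `ε`.
      blockLabeling-isFLC : ∀ {k ε} → k ≡ -1ℤ * R → ∣ ε ∣ ℕ.≤ 1 →
        + size G ≡ + order G * (+ 2 * k - 1ℤ) + ε → IsFLCLabeling 0ℤ b P (corona G H) f
      blockLabeling-isFLC {k} {ε} k≡-R ∣ε∣≤1 size≡ = subst (λ d → ∣ d ∣ ℕ.≤ 1) (sym eq) ∣ε∣≤1
        where
        balance : ∀ n R ε → (n * (+ 2 * (-1ℤ * R) - 1ℤ) + ε) + n * ((R - 1ℤ) + (R + + 2)) ≡ ε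
        balance = solve-∀

        eq : + e 0ℤ b P (corona G H) f 0ℤ - + e 0ℤ b P (corona G H) f 1ℤ ≡ ε
        eq = trans labelImbalance-corona
          (trans (cong (_+ _) (trans size≡ (cong (λ k → + order G * (+ 2 * k - 1ℤ) + ε) k≡-R)))
                 (balance (+ order G) R ε))

-- A variable `t` stands in for `π` so that it can be matched on: 0 is not positive, 1 is excluded
-- by `period≢1`, and at `m + 2` the expression `t ∸ 1` reduces to `suc m`.
corona-path-isFLC : ∀ b k P t → IsPeriod 0ℤ b P t → k ≡ -1ℤ * ∑[ i < t ] τ P (F 0ℤ b (toℕ i)) →
  legendre P (F 0ℤ b 1) ≡ 1ℤ → legendre P (F 0ℤ b 2) ≡ 1ℤ →
  ∀ G → Connected G → ∀ ε → ∣ ε ∣ ℕ.≤ 1 → + size G ≡ + order G * (+ 2 * k - 1ℤ) + ε →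
  IsFLCGraph 0ℤ b P (corona G (path (t ∸ 1)))
corona-path-isFLC b k P zero          (() , _)
corona-path-isFLC b k P (suc zero)    period k≡ □F₁ = contradiction period (period≢1 P □F₁)
corona-path-isFLC b k P (suc (suc m)) period k≡ □F₁ □F₂ G conn ε ∣ε∣≤1 size≡ =
  corona-connected G (path (suc m)) conn ,
  blockLabeling G (path (suc m)) ,
  blockLabeling-isFLC P b m period □F₁ □F₂ G k≡ ∣ε∣≤1 size≡

theorem3p5 : (b : ℤ) → b ≢ 0ℤ →
    (k : ℤ) → 1ℤ ≤ k → χ 0ℤ b k →
    (P : OddPrime) → IsPLPrime k 0ℤ b P →
    legendre P (F 0ℤ b 1) ≡ 1ℤ → legendre P (F 0ℤ b 2) ≡ 1ℤ →
    (G : Graph) → Connected G →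
    (ε : ℤ) → (ε ≡ -1ℤ) ⊎ (ε ≡ 0ℤ) ⊎ (ε ≡ 1ℤ) →
    + size G ≡ + order G * (+ 2 * k - 1ℤ) + ε →
    IsFLCGraph 0ℤ b P (corona G (path (π 0ℤ b P ∸ 1)))
theorem3p5 b _ k _ _ P isPL □F₁ □F₂ G conn ε ε∈ size≡ =
  corona-path-isFLC b k P (π 0ℤ b P) (proj₁ (π-isPisanoPeriod 0ℤ b P)) (isPLPrime-∑ P k 0ℤ b isPL)
    □F₁ □F₂ G conn ε (bounded ε∈) size≡
  where
  bounded : ∀ {ε} → (ε ≡ -1ℤ) ⊎ (ε ≡ 0ℤ) ⊎ (ε ≡ 1ℤ) → ∣ ε ∣ ℕ.≤ 1
  bounded (inj₁ refl)        = s≤s z≤n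
  bounded (inj₂ (inj₁ refl)) = z≤n
  bounded (inj₂ (inj₂ refl)) = s≤s z≤n
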